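{- Let $(\mathcal{X},d)$ be a finite metric space with $n$ points, let $P$ be a probability distribution on $\mathcal{X}$, and let $k\ge1$ be an integer. Let $O\in\mathcal{X}_k$ be an optimal solution of the robotaxi placement problem, i.e. a $k$-multiset minimizing $\mathbb{E}_{X\sim P_k}[d_k(O,X)]$ over $\mathcal{X}_k$. Let $S$ be a random $k$-multiset drawn from $P_k$ (i.e. $k$ points drawn i.i.d. according to $P$), independently of $X$. Then $$\mathbb{E}_{S\sim P_k}\mathbb{E}_{X\sim P_k}[d_k(S,X)]\le 2\cdot\mathbb{E}_{X\sim P_k}[d_k(O,X)].$$
   Context: $\mathcal{X}_k$ is the set of all $k$-element multisets of points of $\mathcal{X}$. For $U,V\in\mathcal{X}_k$, $d_k(U,V)$ is the minimum total cost $\sum d(u,v)$ of a perfect matching between $U$ and $V$ (repeated points treated as distinct copies). $P_k$ is the distribution on $\mathcal{X}_k$ obtained by drawing $k$ points of $\mathcal{X}$ independently according to $P$ and taking the resulting multiset. The cost of $S\in\mathcal{X}_k$ is $\mathbb{E}_{X\sim P_k}[d_k(S,X)]$. -}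

module Defs where

open import Level using (Level; _⊔_; suc)
open import Data.Nat using (ℕ; zero) renaming (suc to sucℕ)
open import Data.Fin using (Fin) renaming (zero to fzero; suc to fsuc)
open import Data.Vec using (Vec; []; _∷_; removeAt)
open import Relation.Nullary using (yes; no)
open import Relation.Binary.PropositionalEquality using (_≡_)
open import Algebra.Bundles using (CommutativeRing)
open import Relation.Binary.Structures using (IsDecTotalOrder)

-- A (discretely) linearly ordered commutative ring, e.g. the real numbers.
-- The statement is quantified over every such ring, in particular over ℝ.
record OrderedCommRing (c ℓ₁ ℓ₂ : Level) : Set (suc (c ⊔ ℓ₁ ⊔ ℓ₂)) where
  field
    commutativeRing : CommutativeRing c ℓ₁
  open CommutativeRing commutativeRing public
  field
    _≤_             : Carrier → Carrier → Set ℓ₂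
    isDecTotalOrder : IsDecTotalOrder _≈_ _≤_
    +-monoʳ-≤       : ∀ z {x y} → x ≤ y → (z + x) ≤ (z + y)
    *-nonneg        : ∀ {x y} → 0# ≤ x → 0# ≤ y → 0# ≤ (x * y)
  open IsDecTotalOrder isDecTotalOrder public using (_≤?_)

  _⊓_ : Carrier → Carrier → Carrier
  x ⊓ y with x ≤? y
  ... | yes _ = x
  ... | no  _ = y

  2# : Carrier
  2# = 1# + 1#

module _ {c ℓ₁ ℓ₂} (R : OrderedCommRing c ℓ₁ ℓ₂) where
  open OrderedCommRing R

  ΣFin : (m : ℕ) → (Fin m → Carrier) → Carrier
  ΣFin zero     f = 0#
  ΣFin (sucℕ m) f = f fzero + ΣFin m (λ i → f (fsuc i))

  minFin : (m : ℕ) → (Fin (sucℕ m) → Carrier) → Carrier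
  minFin zero     f = f fzero
  minFin (sucℕ m) f = f fzero ⊓ minFin m (λ i → f (fsuc i))

  record IsMetric (n : ℕ) (d : Fin n → Fin n → Carrier) : Set (c ⊔ ℓ₁ ⊔ ℓ₂) where
    field
      dist-self : ∀ x → d x x ≈ 0#
      dist-eq   : ∀ x y → d x y ≈ 0# → x ≡ y
      dist-sym  : ∀ x y → d x y ≈ d y x
      dist-tri  : ∀ x y z → d x z ≤ (d x y + d y z)

  record IsProb (n : ℕ) (P : Fin n → Carrier) : Set (ℓ₁ ⊔ ℓ₂) where
    field
      prob-nonneg : ∀ x → 0# ≤ P x
      prob-sum    : ΣFin n P ≈ 1#

  module _ {n : ℕ} (d : Fin n → Fin n → Carrier) where
    -- d_k(U,V): minimum total cost of a perfect matching between U and V.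
    -- The first point of U is matched with some point V j, and the rest
    -- is matched optimally; this ranges over all bijections.
    dk : (k : ℕ) → Vec (Fin n) k → Vec (Fin n) k → Carrier
    dk zero     []       []      = 0#
    dk (sucℕ k) (u ∷ U)  V       =
      minFin k (λ j → d u (lookupV V j) + dk k U (removeAt V j))
      where
        lookupV : ∀ {m} → Vec (Fin n) m → Fin m → Fin n
        lookupV (x ∷ xs) fzero    = x
        lookupV (x ∷ xs) (fsuc i) = lookupV xs i

  module _ {n : ℕ} (P : Fin n → Carrier) where
    E : (k : ℕ) → (Vec (Fin n) k → Carrier) → Carrier
    E zero     f = f []
    E (sucℕ k) f = ΣFin n (λ x → P x * E k (λ T → f (x ∷ T)))

  cost : {n : ℕ} → (Fin n → Fin n → Carrier) → (Fin n → Carrier) →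
         (k : ℕ) → Vec (Fin n) k → Carrier
  cost d P k S = E P k (λ X → dk d k S X)

{-# OPTIONS --safe #-}

-- Composing optimal matchings of O with S and of O with X yields a matching of S with X,
-- so d_k(S,X) ≤ d_k(O,S) + d_k(O,X) by the triangle inequality in 𝒳. Averaging over the
-- independent S and X turns the right-hand side into twice the cost of O.
module Submission where

open import Defs
open import Data.Nat using (ℕ; zero; suc) renaming (_≤_ to _≤ℕ_)
open import Data.Fin using (Fin; zero; suc; punchIn)
open import Data.Vec using (Vec; []; _∷_; lookup; removeAt)
open import Data.Fin.Permutation using (Permutation′; _⟨$⟩ʳ_; id; flip; _∘ₚ_; inverseˡ; remove; insert; punchIn-permute; insert-punchIn)
open import Data.Product using (∃; Σ; _,_; proj₁; proj₂)
open import Function using (_∘_)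
open import Data.Sum using (inj₁; inj₂)
open import Relation.Nullary using (yes; no; contradiction)
open import Relation.Binary.Bundles using (Poset)
open import Relation.Binary.Structures using (IsDecTotalOrder)
open import Relation.Binary.PropositionalEquality as ≡ using (_≡_)
import Algebra.Properties.Semiring.Sum as Sum
import Relation.Binary.Reasoning.PartialOrder as PosetReasoning

lookup-removeAt : ∀ {a} {A : Set a} {k} (V : Vec A (suc k)) j i →
                  lookup (removeAt V j) i ≡ lookup V (punchIn j i)
lookup-removeAt (_ ∷ _)     zero    i       = ≡.refl
lookup-removeAt (_ ∷ _ ∷ _) (suc j) zero    = ≡.refl
lookup-removeAt (_ ∷ w ∷ V) (suc j) (suc i) = lookup-removeAt (w ∷ V) j i

module _ {c ℓ₁ ℓ₂} (R : OrderedCommRing c ℓ₁ ℓ₂) where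
  open OrderedCommRing R hiding (zero)
  open IsDecTotalOrder isDecTotalOrder using (isPartialOrder; total)
    renaming (refl to ≤-refl; trans to ≤-trans; ≤-respˡ-≈ to ≤-respˡ)
  open Sum semiring using (sum; sum-cong-≋; sum-cong-≗; ∑-distrib-+; sum-permute; *-distribʳ-sum)

  poset : Poset c ℓ₁ ℓ₂
  poset = record { isPartialOrder = isPartialOrder }

  open PosetReasoning poset

  +-mono-≤ : ∀ {x y z w} → x ≤ y → z ≤ w → (x + z) ≤ (y + w)
  +-mono-≤ {x} {y} {z} {w} x≤y z≤w = begin
    x + z  ≤⟨ +-monoʳ-≤ x z≤w ⟩
    x + w  ≈⟨ +-comm x w ⟩
    w + x  ≤⟨ +-monoʳ-≤ w x≤y ⟩
    w + y  ≈⟨ +-comm w y ⟩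
    y + w  ∎

  -- The axioms control only products of nonnegative elements, so `y` is split as `x + (- x + y)`,
  -- where the bracket is nonnegative.
  *-monoʳ-≤ : ∀ {p x y} → 0# ≤ p → x ≤ y → (p * x) ≤ (p * y)
  *-monoʳ-≤ {p} {x} {y} 0≤p x≤y = begin
    p * x                      ≈⟨ +-identityʳ _ ⟨
    p * x + 0#                 ≤⟨ +-monoʳ-≤ _ (*-nonneg 0≤p 0≤y-x) ⟩
    p * x + p * (- x + y)      ≈⟨ distribˡ p x (- x + y) ⟨
    p * (x + (- x + y))        ≈⟨ *-congˡ (+-assoc x (- x) y) ⟨
    p * (x + - x + y)          ≈⟨ *-congˡ (+-congʳ (-‿inverseʳ x)) ⟩
    p * (0# + y)               ≈⟨ *-congˡ (+-identityˡ y) ⟩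
    p * y                      ∎
    where
    0≤y-x : 0# ≤ (- x + y)
    0≤y-x = ≤-respˡ (-‿inverseˡ x) (+-monoʳ-≤ (- x) x≤y)

  sum-mono-≤ : ∀ {m} {f g : Fin m → Carrier} → (∀ i → f i ≤ g i) → sum f ≤ sum g
  sum-mono-≤ {zero}  f≤g = ≤-refl
  sum-mono-≤ {suc m} f≤g = +-mono-≤ (f≤g zero) (sum-mono-≤ (f≤g ∘ suc))

  -- Makes the library's additivity and distributivity laws for `sum` available for expectations.
  ΣFin≡sum : ∀ m f → ΣFin R m f ≡ sum f
  ΣFin≡sum zero    f = ≡.refl
  ΣFin≡sum (suc m) f = ≡.cong (f zero +_) (ΣFin≡sum m (f ∘ suc))

  ⊓-≤ˡ : ∀ x y → (x ⊓ y) ≤ x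
  ⊓-≤ˡ x y with x ≤? y | total x y
  ... | yes _   | _        = ≤-refl
  ... | no  x≰y | inj₁ x≤y = contradiction x≤y x≰y
  ... | no  _   | inj₂ y≤x = y≤x

  ⊓-≤ʳ : ∀ x y → (x ⊓ y) ≤ y
  ⊓-≤ʳ x y with x ≤? y
  ... | yes x≤y = x≤y
  ... | no  _   = ≤-refl

  minFin-≤ : ∀ m f j → minFin R m f ≤ f j
  minFin-≤ zero    f zero    = ≤-refl
  minFin-≤ (suc m) f zero    = ⊓-≤ˡ _ _
  minFin-≤ (suc m) f (suc j) = ≤-trans (⊓-≤ʳ _ _) (minFin-≤ m (f ∘ suc) j)

  -- `_⊓_` returns one of its two arguments itself, so the minimum is attained up to `≡` and not
  -- merely up to `≈`.
  minFin-attained : ∀ m f → ∃ λ j → minFin R m f ≡ f j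
  minFin-attained zero    f = zero , ≡.refl
  minFin-attained (suc m) f with f zero ≤? minFin R m (f ∘ suc) | minFin-attained m (f ∘ suc)
  ... | yes _ | _      = zero , ≡.refl
  ... | no  _ | j , eq = suc j , eq

  module _ {n : ℕ} (d : Fin n → Fin n → Carrier) where

    -- Unification against `≡.refl` fills in the function that `dk` minimises, so that `proj₁` gives
    -- a handle on it.
    dk-branches : ∀ k u U V → Σ (Fin (suc k) → Carrier) λ f → dk R d (suc k) (u ∷ U) V ≡ minFin R k f
    dk-branches k u U V = _ , ≡.refl

    -- The lookup function local to dk cannot be named from outside. Unification recovers it as
    -- dkLookup, once the with-abstractions make the arguments it is applied to distinct variables.
    mutual
      dkLookup : ∀ k (u : Fin n) (U : Vec (Fin n) k) (V : Vec (Fin n) (suc k)) {m} →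
                 Vec (Fin n) m → Fin m → Fin n
      dkLookup = _

      dk-branch-dkLookup : ∀ k u U v w V i →
        proj₁ (dk-branches (suc k) u U (v ∷ w ∷ V)) (suc (suc i)) ≡
        d u (dkLookup (suc k) u U (v ∷ w ∷ V) V i) + dk R d (suc k) U (removeAt (v ∷ w ∷ V) (suc (suc i)))
      dk-branch-dkLookup k u U v w V i with dk R d (suc k) U (removeAt (v ∷ w ∷ V) (suc (suc i)))
      ... | _ with v ∷ w ∷ V
      ... | _ with suc k
      ... | _ = ≡.refl

    dkLookup≡lookup : ∀ k u U V {m} (W : Vec (Fin n) m) i → dkLookup k u U V W i ≡ lookup W i
    dkLookup≡lookup k u U V (x ∷ W) zero    = ≡.refl
    dkLookup≡lookup k u U V (x ∷ W) (suc i) = dkLookup≡lookup k u U V W i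

    -- At indices 0 and 1 both lookups compute. Further on they are stuck on `V` and `i`, and
    -- `dk-branch-dkLookup` takes over. Two entries are split off there so that the ambient `suc k`
    -- can be abstracted separately from the length `k` of `V`.
    dk-branch : ∀ k u U V j →
      proj₁ (dk-branches k u U V) j ≡ d u (lookup V j) + dk R d k U (removeAt V j)
    dk-branch k       u U (v ∷ V)     zero          = ≡.refl
    dk-branch (suc k) u U (v ∷ w ∷ V) (suc zero)    = ≡.refl
    dk-branch (suc k) u U (v ∷ w ∷ V) (suc (suc i)) = ≡.trans
      (dk-branch-dkLookup k u U v w V i)
      (≡.cong (λ x → d u x + dk R d (suc k) U (removeAt (v ∷ w ∷ V) (suc (suc i))))
        (dkLookup≡lookup (suc k) u U (v ∷ w ∷ V) V i))

    matchingCost : ∀ {k} → Vec (Fin n) k → Vec (Fin n) k → Permutation′ k → Carrier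
    matchingCost U V π = sum (λ i → d (lookup U i) (lookup V (π ⟨$⟩ʳ i)))

    -- Relating `π` to `j` and `ρ` by equations lets one lemma serve both directions: removing the
    -- first pair from a given `π`, and inserting a first pair into a given `ρ`.
    matchingCost-∷ : ∀ {k} u (U : Vec (Fin n) k) V π j ρ → π ⟨$⟩ʳ zero ≡ j →
      (∀ i → π ⟨$⟩ʳ suc i ≡ punchIn j (ρ ⟨$⟩ʳ i)) →
      matchingCost (u ∷ U) V π ≡ d u (lookup V j) + matchingCost U (removeAt V j) ρ
    matchingCost-∷ u U V π j ρ π0≡j πs≡ = ≡.cong₂ _+_
      (≡.cong (d u ∘ lookup V) π0≡j)
      (sum-cong-≗ λ i → ≡.cong (d (lookup U i))
        (≡.trans (≡.cong (lookup V) (πs≡ i)) (≡.sym (lookup-removeAt V j (ρ ⟨$⟩ʳ i)))))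

    -- The partner that `π` gives to the first point is one of the candidates in the minimum.
    -- Deleting that pair leaves a permutation to which induction applies.
    dk-≤-matchingCost : ∀ k U V π → dk R d k U V ≤ matchingCost U V π
    dk-≤-matchingCost zero    []      [] π = ≤-refl
    dk-≤-matchingCost (suc k) (u ∷ U) V  π = begin
      dk R d (suc k) (u ∷ U) V                              ≤⟨ minFin-≤ k _ j ⟩
      proj₁ (dk-branches k u U V) j                         ≡⟨ dk-branch k u U V j ⟩
      d u (lookup V j) + dk R d k U (removeAt V j)          ≤⟨ +-monoʳ-≤ _ (dk-≤-matchingCost k U (removeAt V j) ρ) ⟩
      d u (lookup V j) + matchingCost U (removeAt V j) ρ    ≡⟨ matchingCost-∷ u U V π j ρ ≡.refl (punchIn-permute π zero) ⟨
      matchingCost (u ∷ U) V π                              ∎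
      where
      j = π ⟨$⟩ʳ zero
      ρ = remove zero π

    -- A minimising partner `j` for the first point extends the optimal permutation of the remaining
    -- points. With the preceding bound, `dk` is thus the minimum over all permutations.
    dk-attained : ∀ k U V → ∃ λ π → dk R d k U V ≡ matchingCost U V π
    dk-attained zero    []      [] = id , ≡.refl
    dk-attained (suc k) (u ∷ U) V  with minFin-attained k (proj₁ (dk-branches k u U V))
    ... | j , min≡ with dk-attained k U (removeAt V j)
    ...   | ρ , dk≡ = insert zero j ρ ,
      ≡.trans min≡ (≡.trans (dk-branch k u U V j) (≡.trans
        (≡.cong (d u (lookup V j) +_) dk≡)
        (≡.sym (matchingCost-∷ u U V (insert zero j ρ) j ρ ≡.refl (insert-punchIn zero j ρ)))))

    dk-triangle : IsMetric R n d → ∀ k O S X → dk R d k S X ≤ (dk R d k O S + dk R d k O X)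
    dk-triangle metric k O S X with dk-attained k O S | dk-attained k O X
    ... | ρ , dkOS≡ | π , dkOX≡ = begin
      -- `∘ₚ` applies its left factor first: back along `ρ` from `S` to `O`, then along `π` from `O`
      -- to `X`.
      dk R d k S X                                            ≤⟨ dk-≤-matchingCost k S X (flip ρ ∘ₚ π) ⟩
      -- Reindexing by `ρ` makes the sum run over the points of `O`, after which `ρ` cancels against
      -- its inverse.
      matchingCost S X (flip ρ ∘ₚ π)                          ≈⟨ sum-permute _ ρ ⟩
      sum (λ i → d (s i) (lookup X (flip ρ ∘ₚ π ⟨$⟩ʳ (ρ ⟨$⟩ʳ i))))
        ≡⟨ sum-cong-≗ (λ i → ≡.cong (λ h → d (s i) (lookup X (π ⟨$⟩ʳ h))) (inverseˡ ρ)) ⟩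
      sum (λ i → d (s i) (x i))                               ≤⟨ sum-mono-≤ (λ i → dist-tri (s i) (o i) (x i)) ⟩
      sum (λ i → d (s i) (o i) + d (o i) (x i))               ≈⟨ ∑-distrib-+ (λ i → d (s i) (o i)) _ ⟩
      sum (λ i → d (s i) (o i)) + matchingCost O X π          ≈⟨ +-congʳ (sum-cong-≋ (λ i → dist-sym (s i) (o i))) ⟩
      matchingCost O S ρ + matchingCost O X π                 ≡⟨ ≡.cong₂ _+_ dkOS≡ dkOX≡ ⟨
      dk R d k O S + dk R d k O X                             ∎
      where
      open IsMetric metric
      o s x : Fin k → Fin n
      o i = lookup O i
      s i = lookup S (ρ ⟨$⟩ʳ i)
      x i = lookup X (π ⟨$⟩ʳ i)

  module _ {n : ℕ} {P : Fin n → Carrier} (prob : IsProb R n P) where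
    open IsProb prob

    E-suc : ∀ k f → E R P (suc k) f ≡ sum (λ x → P x * E R P k (f ∘ (x ∷_)))
    E-suc k f = ΣFin≡sum n _

    E-mono-≤ : ∀ k {f g} → (∀ T → f T ≤ g T) → E R P k f ≤ E R P k g
    E-mono-≤ zero    f≤g = f≤g []
    E-mono-≤ (suc k) {f} {g} f≤g = begin
      E R P (suc k) f                            ≡⟨ E-suc k f ⟩
      sum (λ x → P x * E R P k (f ∘ (x ∷_)))     ≤⟨ sum-mono-≤ (λ x → *-monoʳ-≤ (prob-nonneg x) (E-mono-≤ k (f≤g ∘ (x ∷_)))) ⟩
      sum (λ x → P x * E R P k (g ∘ (x ∷_)))     ≡⟨ E-suc k g ⟨
      E R P (suc k) g                            ∎

    E-+ : ∀ k f g → E R P k (λ T → f T + g T) ≈ E R P k f + E R P k g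
    E-+ zero    f g = refl
    E-+ (suc k) f g = begin-equality
      E R P (suc k) (λ T → f T + g T)
        ≡⟨ E-suc k (λ T → f T + g T) ⟩
      sum (λ x → P x * E R P k (λ T → f (x ∷ T) + g (x ∷ T)))
        ≈⟨ sum-cong-≋ (λ x → trans (*-congˡ (E-+ k (f ∘ (x ∷_)) (g ∘ (x ∷_)))) (distribˡ _ _ _)) ⟩
      sum (λ x → P x * E R P k (f ∘ (x ∷_)) + P x * E R P k (g ∘ (x ∷_)))
        ≈⟨ ∑-distrib-+ (λ x → P x * E R P k (f ∘ (x ∷_))) _ ⟩
      sum (λ x → P x * E R P k (f ∘ (x ∷_))) + sum (λ x → P x * E R P k (g ∘ (x ∷_)))
        ≡⟨ ≡.cong₂ _+_ (E-suc k f) (E-suc k g) ⟨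
      E R P (suc k) f + E R P (suc k) g
        ∎

    -- Each of the `k` draws contributes a factor equal to the total mass of `P`, which is 1.
    E-const : ∀ k a → E R P k (λ _ → a) ≈ a
    E-const zero    a = refl
    E-const (suc k) a = begin-equality
      E R P (suc k) (λ _ → a)                 ≡⟨ E-suc k (λ _ → a) ⟩
      sum (λ x → P x * E R P k (λ _ → a))     ≈⟨ sum-cong-≋ (λ x → *-congˡ {P x} (E-const k a)) ⟩
      sum (λ x → P x * a)                     ≈⟨ *-distribʳ-sum a P ⟨
      sum P * a                               ≡⟨ ≡.cong (_* a) (ΣFin≡sum n P) ⟨
      ΣFin R n P * a                          ≈⟨ *-congʳ prob-sum ⟩
      1# * a                                  ≈⟨ *-identityˡ a ⟩
      a                                       ∎

theorem1 : ∀ {c ℓ₁ ℓ₂} (R : OrderedCommRing c ℓ₁ ℓ₂) →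
    let open OrderedCommRing R in
    (n : ℕ) (d : Fin n → Fin n → Carrier) (P : Fin n → Carrier) (k : ℕ) →
    IsMetric R n d → IsProb R n P → 1 ≤ℕ k →
    (O : Vec (Fin n) k) →
    (∀ (T : Vec (Fin n) k) → cost R d P k O ≤ cost R d P k T) →
    E R P k (λ S → E R P k (λ X → dk R d k S X)) ≤ (2# * cost R d P k O)
theorem1 R n d P k metric prob _ O _ = begin
  E R P k (λ S → E R P k (λ X → dk R d k S X))
    ≤⟨ E-mono-≤ R prob k (λ S → E-mono-≤ R prob k (dk-triangle R d metric k O S)) ⟩
  E R P k (λ S → E R P k (λ X → dk R d k O S + dk R d k O X))
    -- For fixed `S` the first summand is constant in `X`. The resulting equality passes under the
    -- outer expectation by monotonicity.
    ≤⟨ E-mono-≤ R prob k (λ S → ≤-reflexive (average-over-X S)) ⟩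
  E R P k (λ S → dk R d k O S + C)
    -- Since `S` and `X` have the same distribution, averaging `dk R d k O` over `S` is by
    -- definition `C` again.
    ≈⟨ E-+ R prob k (dk R d k O) (λ _ → C) ⟩
  C + E R P k (λ _ → C)
    ≈⟨ +-congˡ (E-const R prob k C) ⟩
  C + C
    ≈⟨ +-cong (*-identityˡ C) (*-identityˡ C) ⟨
  1# * C + 1# * C
    ≈⟨ distribʳ C 1# 1# ⟨
  2# * C
    ∎
  where
  open OrderedCommRing R
  open IsDecTotalOrder isDecTotalOrder using () renaming (reflexive to ≤-reflexive)
  open PosetReasoning (poset R)
  C = cost R d P k O
  average-over-X : ∀ S → E R P k (λ X → dk R d k O S + dk R d k O X) ≈ dk R d k O S + C
  average-over-X S = trans (E-+ R prob k (λ _ → dk R d k O S) (dk R d k O)) (+-congʳ (E-const R prob k _))
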